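{- Let $r\ge 4$ and $k\ge 2$ be integers, and let $K$ be an $m$-chromatic graph with $h_r(K)<k$. Fix a proper surjective $m$-colouring $\varphi:V(K)\to[m]$, and put $a=k-1$. For a cycle $C$ of $K$ let $$\Pi(C)=\bigl\{\{\varphi(x),\varphi(y)\}: xy\in E(C)\bigr\}\subseteq\binom{[m]}2 .$$ (a) If $\eta:V(K)\to[a]$ is any map and $P_\eta$ is the graph on $[m]$ in which $ij$ is an edge when some edge of $K$ between the colour classes $\varphi^{ -1}(i)$ and $\varphi^{ -1}(j)$ is $\eta$-monochromatic (its two ends have the same $\eta$-value), then $\alpha(P_\eta)\le a$. Consequently, $$e(P_\eta)\ge \frac{m^2}{2a}-\frac m2 .$$ (b) If $T$ is a graph on $[m]$ whose edge set meets $\Pi(C)$ for every cycle $C$ of $K$ of length less than $r$, then $\alpha(T)\le a$ and hence $$e(T)\ge \frac{m^2}{2a}-\frac m2 .$$ (c) The graph $K$ contains a family $\mathcal M$ of cycles of length less than $r$ such that the sets $\Pi(C)$, $C\in\mathcal M$, are pairwise disjoint and $$|\mathcal M|\ge \frac1{r-1}\left(\frac{m^2}{2a}-\frac m2\right).$$ These cycles are pairwise edge-disjoint in $K$.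
   Context: All graphs are finite and simple; subgraphs need not be induced. $\chi$ is the chromatic number, $\alpha$ the independence number, $e$ the number of edges; $[m]=\{1,\dots,m\}$. $m$-chromatic means $\chi(K)=m$. The girth of a forest is $\infty$. $h_r(K)=\max\{\chi(H):H\subseteq K,\ \operatorname{girth}(H)\ge r\}$. -}

module Defs where

open import Data.Fin using (Fin; toℕ; _<?_)
open import Data.Fin.Properties using (any?; _≟_)
open import Data.Fin.Subset using (Subset; ∣_∣) renaming (_∈_ to _∈ₛ_)
open import Data.Integer using (+_)
open import Data.List using (List; length; filter; cartesianProduct; allFin)
open import Data.Nat using (ℕ; suc; _+_; _*_; _∸_; _≤_; s≤s; NonZero)
open import Data.Nat.Properties using (m*n≢0)
open import Data.Product using (∃; ∃₂; ∃-syntax; Σ-syntax; _×_; _,_)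
open import Data.Rational as ℚ using (ℚ; _/_)
open import Data.Sum using (_⊎_)
open import Function.Definitions using (Injective)
open import Level using (Level; 0ℓ)
open import Relation.Binary.Construct.Add.Supremum.NonStrict _≤_ using (_≤⁺_)
open import Relation.Binary.Construct.Closure.Symmetric using (SymClosure)
open import Relation.Binary.Core using (Rel)
open import Relation.Binary.Definitions using (Decidable; Irreflexive; Symmetric)
open import Relation.Binary.PropositionalEquality using (_≡_; _≢_; refl; sym; trans)
open import Relation.Nullary using (¬_; _×-dec_)
open import Relation.Nullary.Construct.Add.Supremum using (_⁺; ⊤⁺; [_])

IsMinimum : ∀ {p : Level} → (ℕ → Set p) → ℕ → Set p
IsMinimum P c = P c × (∀ d → P d → c ≤ d)

IsMaximum : ∀ {p : Level} → (ℕ → Set p) → ℕ → Set p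
IsMaximum P c = P c × (∀ d → P d → d ≤ c)

-- A finite simple graph with vertex set Fin n.
record Graph (n : ℕ) : Set₁ where
  infix 4 _~_ _~?_
  field
    _~_    : Rel (Fin n) 0ℓ
    _~?_   : Decidable _~_
    ~-sym  : Symmetric _~_
    irrefl : Irreflexive _≡_ _~_

open Graph public using () renaming (_~_ to Adj)

-- Vertex sets are always of the form Fin n, so a (not necessarily induced,
-- not necessarily spanning) subgraph is given together with the inclusion of
-- its vertex set.
infix 4 _⊆ᴳ_
record _⊆ᴳ_ {h n : ℕ} (H : Graph h) (K : Graph n) : Set where
  field
    incl      : Fin h → Fin n
    injective : Injective _≡_ _≡_ incl
    edges     : ∀ {x y} → Adj H x y → Adj K (incl x) (incl y)

edgeCount : ∀ {n} → Graph n → ℕ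
edgeCount {n} G =
  length (filter (λ { (x , y) → x <? y ×-dec x ~? y })
                 (cartesianProduct (allFin n) (allFin n)))
  where open Graph G

Proper : ∀ {n c} → Graph n → (Fin n → Fin c) → Set
Proper G f = ∀ {x y} → Adj G x y → f x ≢ f y

Colourable : ∀ {n} → Graph n → ℕ → Set
Colourable {n} G c = Σ[ f ∈ (Fin n → Fin c) ] Proper G f

ChromaticNumber : ∀ {n} → Graph n → ℕ → Set
ChromaticNumber G = IsMinimum (Colourable G)

Independent : ∀ {n} → Graph n → Subset n → Set
Independent G S = ∀ {x y} → x ∈ₛ S → y ∈ₛ S → ¬ Adj G x y

IndependenceNumber : ∀ {n} → Graph n → ℕ → Set
IndependenceNumber {n} G =
  IsMaximum (λ s → Σ[ S ∈ Subset n ] (Independent G S × ∣ S ∣ ≡ s))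

-- The cyclic successor relation on 0, …, ℓ-1.
infix 4 _↝_
_↝_ : ∀ {ℓ} → Rel (Fin ℓ) 0ℓ
_↝_ {ℓ} i j = toℕ j ≡ suc (toℕ i) ⊎ (suc (toℕ i) ≡ ℓ × toℕ j ≡ 0)

record Cycle {n : ℕ} (G : Graph n) : Set where
  field
    len       : ℕ
    3≤len     : 3 ≤ len
    vertex    : Fin len → Fin n
    injective : Injective _≡_ _≡_ vertex
    adjacent  : ∀ {i j} → i ↝ j → Adj G (vertex i) (vertex j)

open Cycle public using (len)

-- Sets of unordered pairs are represented by symmetric relations.
CycleEdge : ∀ {n} {G : Graph n} → Cycle G → Rel (Fin n) 0ℓ
CycleEdge C =
  SymClosure (λ x y → ∃₂ λ i j → i ↝ j × vertex i ≡ x × vertex j ≡ y)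
  where open Cycle C

Π : ∀ {n m} {G : Graph n} → (Fin n → Fin m) → Cycle G → Rel (Fin m) 0ℓ
Π φ C i j = ∃₂ λ x y → CycleEdge C x y × φ x ≡ i × φ y ≡ j

Meets : ∀ {n} → Rel (Fin n) 0ℓ → Rel (Fin n) 0ℓ → Set
Meets R S = ∃₂ λ i j → R i j × S i j

Disjoint : ∀ {n} → Rel (Fin n) 0ℓ → Rel (Fin n) 0ℓ → Set
Disjoint R S = ¬ Meets R S

-- Girth takes values in ℕ ∪ {∞}, with ∞ written ⊤⁺.
Girth : ∀ {n} → Graph n → ℕ ⁺ → Set
Girth G ⊤⁺    = ¬ Cycle G
Girth G [ g ] = IsMinimum (λ ℓ → Σ[ C ∈ Cycle G ] len C ≡ ℓ) g

-- HighGirthChromatic r K h says that h = h_r(K).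
HighGirthChromatic : ∀ {n} → ℕ → Graph n → ℕ → Set₁
HighGirthChromatic r K = IsMaximum λ c →
  ∃[ v ] Σ[ H ∈ Graph v ]
    ( H ⊆ᴳ K
    × (∃[ g ] (Girth H g × [ r ] ≤⁺ g))
    × ChromaticNumber H c )

monochromaticGraph : ∀ {n m a} (K : Graph n) (φ : Fin n → Fin m) → Proper K φ →
                     (Fin n → Fin a) → Graph m
monochromaticGraph K φ φ-proper η = record
  { _~_    = λ i j → ∃₂ λ x y → x ~ y × φ x ≡ i × φ y ≡ j × η x ≡ η y
  ; _~?_   = λ i j → any? λ x → any? λ y →
               x ~? y ×-dec φ x ≟ i ×-dec φ y ≟ j ×-dec η x ≟ η y
  ; ~-sym  = λ { (x , y , x~y , φx , φy , η≡) →
                 y , x , ~-sym x~y , φy , φx , sym η≡ }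
  ; irrefl = λ { refl (x , y , x~y , φx , φy , _) →
                 φ-proper x~y (trans φx (sym φy)) }
  }
  where open Graph K

-- m²/(2a) - m/2
turánBound : (m a : ℕ) → .{{NonZero a}} → ℚ
turánBound m a = (+ (m * m) / (2 * a)) {{m*n≢0 2 a}} ℚ.- + m / 2

pred-nonZero : ∀ {b n} → 2 + b ≤ n → NonZero (n ∸ 1)
pred-nonZero (s≤s (s≤s _)) = _

{-# OPTIONS --safe #-}

-- (a) If S is independent in P_η, recolouring the classes in S by η keeps the
-- colouring of K proper, so m ≤ a + (m - |S|).  The edge bound is Turán's
-- theorem for graphs of independence number at most a.
-- (b) Delete from K the edges whose colour pair is an edge of T.  No short cycle
-- survives, so the remaining graph has girth at least r and hence an
-- a-colouring η.  Every η-monochromatic edge of K was deleted, so P_η ⊆ T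
-- and (a) bounds α(T).
-- (c) Apply (b) to the union T of the sets Π(C) of a maximal family of short
-- cycles with pairwise disjoint Π(C), which has at most (r - 1)|M| edges.
-- Since all graphs are finite and decidable, girths, chromatic numbers and
-- maximal families are found by exhaustive search.
module Submission where

open import Defs
open import Data.Fin as Fin using (Fin; zero; suc; toℕ; fromℕ<; finToFun; funToFin; inject≤; join; splitAt)
import Data.Fin.Properties as Fin
open import Data.Fin.Subset using (Subset; ∣_∣; inside; outside; ∁) renaming (_∈_ to _∈ₛ_; ⊥ to ∅)
import Data.Fin.Subset.Properties as Subset
open import Data.Integer as ℤ using (+_)
import Data.Integer.Properties as ℤ
open import Data.List using (List; []; _∷_; _++_; length; filter; map; concatMap; cartesianProduct; allFin; lookup)
import Data.List.Extrema.Nat as Extrema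
import Data.List.Membership.DecPropositional as DecMembership
open import Data.List.Membership.Propositional using (_∈_; find; lose)
open import Data.List.Membership.Propositional.Properties
open import Data.List.Membership.Setoid.Properties using (index-injective)
open import Data.List.Properties using (length-++; length-map; filter-++; filter-notAll; length-tabulate)
open import Data.List.Relation.Binary.Subset.Propositional using (_⊆_)
open import Data.List.Relation.Unary.All as All using (All; []; _∷_)
open import Data.List.Relation.Unary.AllPairs as AllPairs using (AllPairs; []; _∷_)
open import Data.List.Relation.Unary.Any as Any using (Any; here; there)
open import Data.List.Relation.Unary.Unique.Propositional using (Unique)
import Data.List.Relation.Unary.Unique.Propositional.Properties as Unique
open import Data.Nat hiding (_/_)
open import Data.Nat.Induction using (<-rec)
open import Data.Nat.ListAction using (sum)
open import Data.Nat.Properties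
open import Data.Nat.Tactic.RingSolver using (solve-∀)
open import Data.Product using (∃; ∃₂; ∃-syntax; Σ-syntax; _×_; _,_; proj₁; proj₂; swap)
open import Data.Rational as ℚ using (_/_)
import Data.Rational.Properties as ℚ
import Data.Rational.Unnormalised as ℚᵘ
import Data.Rational.Unnormalised.Properties as ℚᵘ
open import Data.Sum using (_⊎_; inj₁; inj₂)
open import Data.Sum.Properties using (inj₁-injective; inj₂-injective)
open import Data.Vec using (_∷_; here; there; tabulate)
import Data.Vec.Properties as Vec
open import Function using (_∘_; id)
open import Function.Definitions using (Surjective)
open import Level using (Level)
open import Relation.Binary.Construct.Add.Supremum.NonStrict _≤_ using (_≤⁺_; [_]; _≤⊤⁺)
open import Relation.Binary.Construct.Closure.Symmetric as SymClosure using (fwd; bwd)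
open import Relation.Binary.Core using (Rel)
open import Relation.Binary.Definitions using (Decidable; Reflexive; Symmetric; tri<; tri≈; tri>)
open import Relation.Binary.PropositionalEquality
open import Relation.Nullary using (¬_; Dec; yes; no; does; ¬?; _×-dec_; _⊎-dec_; _→-dec_; contradiction)
open import Relation.Nullary.Construct.Add.Supremum using (⊤⁺; [_])
open import Relation.Nullary.Decidable using (map′; dec-true)
import Relation.Unary as Unary

private
  variable
    p : Level
    A : Set
    h m n r a b c : ℕ

-- Quadratic inequalities over the naturals.

-- The two sides differ by the square of the distance `d` between `x` and `y`. Writing the larger
-- number as the smaller plus `d` avoids subtraction.
2xy≤x²+y² : ∀ x y → x * y + x * y ≤ x * x + y * y
2xy≤x²+y² x y with ≤-total x y
... | inj₁ x≤y with d , refl ← m≤n⇒∃[o]m+o≡n x≤y =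
  ≤-trans (m≤m+n _ (d * d)) (≤-reflexive (eq x d))
  where
  eq : ∀ x d → x * (x + d) + x * (x + d) + d * d ≡ x * x + (x + d) * (x + d)
  eq = solve-∀
... | inj₂ y≤x with d , refl ← m≤n⇒∃[o]m+o≡n y≤x =
  ≤-trans (m≤m+n _ (d * d)) (≤-reflexive (eq y d))
  where
  eq : ∀ y d → (y + d) * y + (y + d) * y + d * d ≡ (y + d) * (y + d) + y * y
  eq = solve-∀

-- (t + s)² ≤ (1 + b)(t² + s² / b), cleared of the denominator.
square-+-≤ : ∀ b t s X → s * s ≤ b * X → (t + s) * (t + s) ≤ suc b * (t * t + X)
-- For `b = 0` the hypothesis forces `s = 0`.
square-+-≤ zero t zero X _ =
  ≤-trans (≤-reflexive (eq t)) (*-monoʳ-≤ 1 (m≤m+n (t * t) X))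
  where
  eq : ∀ t → (t + 0) * (t + 0) ≡ 1 * (t * t)
  eq = solve-∀
square-+-≤ b@(suc _) t s X s²≤bX = begin
  (t + s) * (t + s)                          ≡⟨ eq₁ t s ⟩
  (t * s + t * s) + (t * t + s * s)          ≤⟨ +-mono-≤ 2ts≤ (+-monoʳ-≤ (t * t) s²≤bX) ⟩
  (b * (t * t) + X) + (t * t + b * X)        ≡⟨ eq₂ b t X ⟩
  suc b * (t * t + X)                        ∎
  where
  open ≤-Reasoning
  eq₁ : ∀ t s → (t + s) * (t + s) ≡ (t * s + t * s) + (t * t + s * s)
  eq₁ = solve-∀
  eq₂ : ∀ b t X → (b * (t * t) + X) + (t * t + b * X) ≡ (1 + b) * (t * t + X)
  eq₂ = solve-∀
  eq₃ : ∀ b t s → b * (t * s + t * s) ≡ (b * t) * s + (b * t) * s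
  eq₃ = solve-∀
  eq₄ : ∀ b t X → (b * t) * (b * t) + b * X ≡ b * (b * (t * t) + X)
  eq₄ = solve-∀
  2ts≤ : t * s + t * s ≤ b * (t * t) + X
  -- The inequality 2xy ≤ x² + y² is used for `b * t` and `s`; the common factor `b` is then
  -- positive and cancels.
  2ts≤ = *-cancelˡ-≤ b (begin
    b * (t * s + t * s)         ≡⟨ eq₃ b t s ⟩
    (b * t) * s + (b * t) * s   ≤⟨ 2xy≤x²+y² (b * t) s ⟩
    (b * t) * (b * t) + s * s   ≤⟨ +-monoʳ-≤ ((b * t) * (b * t)) s²≤bX ⟩
    (b * t) * (b * t) + b * X   ≡⟨ eq₄ b t X ⟩
    b * (b * (t * t) + X)       ∎)

-- Counting and summing over filtered lists.

module _ {P : A → Set p} (P? : Unary.Decidable P) where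

  length-filter-split : ∀ xs →
    length xs ≡ length (filter P? xs) + length (filter (¬? ∘ P?) xs)
  length-filter-split []       = refl
  length-filter-split (x ∷ xs) with P? x
  ... | yes _ = cong suc (length-filter-split xs)
  ... | no  _ = trans (cong suc (length-filter-split xs)) (sym (+-suc _ _))

  sum-filter-split : ∀ (f : A → ℕ) xs →
    sum (map f xs) ≡ sum (map f (filter P? xs)) + sum (map f (filter (¬? ∘ P?) xs))
  sum-filter-split f []       = refl
  sum-filter-split f (x ∷ xs) with P? x
  ... | yes _ = trans (cong (_+_ (f x)) (sum-filter-split f xs)) (sym (+-assoc (f x) _ _))
  ... | no  _ = trans (cong (_+_ (f x)) (sum-filter-split f xs)) (eq (f x) (sum (map f (filter P? xs))) _)
    where
    eq : ∀ a b c → a + (b + c) ≡ b + (a + c)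
    eq = solve-∀

  length-filter-filter-≤ : ∀ {q} {Q : A → Set q} (Q? : Unary.Decidable Q) xs →
    length (filter P? (filter Q? xs)) ≤ length (filter P? xs)
  length-filter-filter-≤ Q? []       = z≤n
  length-filter-filter-≤ Q? (x ∷ xs) with Q? x
  ... | yes _ with P? x
  ...   | yes _ = s≤s (length-filter-filter-≤ Q? xs)
  ...   | no  _ = length-filter-filter-≤ Q? xs
  length-filter-filter-≤ Q? (x ∷ xs) | no _ with P? x
  ...   | yes _ = m≤n⇒m≤1+n (length-filter-filter-≤ Q? xs)
  ...   | no  _ = length-filter-filter-≤ Q? xs

length*≤sum : ∀ (f : A → ℕ) t {xs} → All (λ x → t ≤ f x) xs → length xs * t ≤ sum (map f xs)
length*≤sum f t []           = z≤n
length*≤sum f t (t≤fx ∷ all) = +-mono-≤ t≤fx (length*≤sum f t all)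

sum-map-mono : ∀ (f g : A → ℕ) → (∀ x → f x ≤ g x) → ∀ xs → sum (map f xs) ≤ sum (map g xs)
sum-map-mono f g f≤g []       = z≤n
sum-map-mono f g f≤g (x ∷ xs) = +-mono-≤ (f≤g x) (sum-map-mono f g f≤g xs)

minimiser : ∀ (f : A → ℕ) x xs → ∃[ v ] v ∈ x ∷ xs × All (λ y → f v ≤ f y) (x ∷ xs)
minimiser f x xs = Extrema.argmin f x xs , v∈ , Extrema.f[argmin]≤f[⊤] {f = f} x xs ∷ Extrema.f[argmin]≤f[xs] x xs
  where
  v∈ : Extrema.argmin f x xs ∈ x ∷ xs
  v∈ with Extrema.argmin-sel f x xs
  ... | inj₁ eq = here eq
  ... | inj₂ ∈xs = there ∈xs

-- Greedy independent sets and degree sums.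

module _ {R : Rel A p} (R? : Decidable R) (R-refl : Reflexive R) where

  -- Closed neighbourhoods are counted: by reflexivity an entry of `xs` contributes to its own
  -- degree.
  degree : List A → A → ℕ
  degree xs x = length (filter (R? x) xs)

  -- Turán's bound by the greedy algorithm: for v of minimal degree t, the
  -- neighbourhood of v accounts for at least t² related pairs.
  greedyIndependent : ∀ xs → ∃[ ys ] ys ⊆ xs × AllPairs (λ x y → ¬ R x y) ys ×
    length xs * length xs ≤ length ys * sum (map (degree xs) xs)
  greedyIndependent xs = <-rec Claim step (length xs) xs refl
    where
    Claim : ℕ → Set _
    Claim n = ∀ xs → length xs ≡ n → ∃[ ys ] ys ⊆ xs × AllPairs (λ x y → ¬ R x y) ys ×
      length xs * length xs ≤ length ys * sum (map (degree xs) xs)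

    step : ∀ n → (∀ {k} → k < n → Claim k) → Claim n
    step _ rec []          refl = [] , id , [] , z≤n
    step _ rec xs@(x ∷ xs₀) refl
      with v , v∈xs , v-min ← minimiser (degree xs) x xs₀
      with ys , ys⊆xs′ , indep , bound ←
        -- Being related to itself, `v` is filtered out, so the remaining list is strictly shorter.
        rec (filter-notAll (¬? ∘ R? v) xs (lose v∈xs (λ ¬vv → ¬vv R-refl)))
            (filter (¬? ∘ R? v) xs) refl
      = v ∷ ys , ⊆xs , All.tabulate (proj₂ ∘ ∈-filter⁻ (¬? ∘ R? v) ∘ ys⊆xs′) ∷ indep , (begin
        length xs * length xs   ≡⟨ cong₂ _*_ split split ⟩
        (t + s) * (t + s)       ≤⟨ square-+-≤ (length ys) t s _ bound ⟩
        suc (length ys) * (t * t + sum (map (degree xs′) xs′))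
          ≤⟨ *-monoʳ-≤ (suc (length ys)) (+-mono-≤ near far) ⟩
        suc (length ys) * (sum (map (degree xs) (filter (R? v) xs)) + sum (map (degree xs) xs′))
          ≡⟨ cong (suc (length ys) *_) (sum-filter-split (R? v) (degree xs) xs) ⟨
        suc (length ys) * sum (map (degree xs) xs) ∎)
      where
      open ≤-Reasoning
      xs′ : List _
      xs′ = filter (¬? ∘ R? v) xs
      t s : ℕ
      t = degree xs v
      s = length xs′
      split : length xs ≡ t + s
      split = length-filter-split (R? v) xs
      near : t * t ≤ sum (map (degree xs) (filter (R? v) xs))
      near = length*≤sum (degree xs) t
        (All.tabulate (All.lookup v-min ∘ proj₁ ∘ ∈-filter⁻ (R? v)))
      -- Passing to the sublist can only lower degrees.
      far : sum (map (degree xs′) xs′) ≤ sum (map (degree xs) xs′)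
      far = sum-map-mono _ _ (λ y → length-filter-filter-≤ (R? y) (¬? ∘ R? v) xs) xs′
      ⊆xs : v ∷ ys ⊆ xs
      ⊆xs (here refl)  = v∈xs
      ⊆xs (there y∈ys) = proj₁ (∈-filter⁻ (¬? ∘ R? v) (ys⊆xs′ y∈ys))

  sum-degree : ∀ xs ys →
    sum (map (degree ys) xs) ≡ length (filter (λ (x , y) → R? x y) (cartesianProduct xs ys))
  sum-degree []       ys = refl
  sum-degree (x ∷ xs) ys = begin
    degree ys x + sum (map (degree ys) xs)
      ≡⟨ cong₂ _+_ (row ys) (sum-degree xs ys) ⟩
    length (filter R²? (map (x ,_) ys)) + length (filter R²? (cartesianProduct xs ys))
      ≡⟨ length-++ (filter R²? (map (x ,_) ys)) ⟨
    length (filter R²? (map (x ,_) ys) ++ filter R²? (cartesianProduct xs ys))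
      ≡⟨ cong length (filter-++ R²? (map (x ,_) ys) _) ⟨
    length (filter R²? (cartesianProduct (x ∷ xs) ys)) ∎
    where
    open ≡-Reasoning
    R²? : Unary.Decidable (λ ((x , y) : A × A) → R x y)
    R²? (x , y) = R? x y
    row : ∀ ys → degree ys x ≡ length (filter R²? (map (x ,_) ys))
    row []       = refl
    row (y ∷ ys) with R? x y
    ... | yes _ = cong suc (row ys)
    ... | no  _ = row ys

-- Duplicate-free lists and finite subsets.

unique-lookup-injective : {xs : List A} → Unique xs → ∀ {i j} → lookup xs i ≡ lookup xs j → i ≡ j
unique-lookup-injective (_ ∷ _)     {zero}  {zero}  _  = refl
unique-lookup-injective (x∉xs ∷ _)  {zero}  {suc j} eq = contradiction eq (All.lookup x∉xs (∈-lookup j))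
unique-lookup-injective (x∉xs ∷ _)  {suc i} {zero}  eq = contradiction (sym eq) (All.lookup x∉xs (∈-lookup i))
unique-lookup-injective (_ ∷ xs!)   {suc i} {suc j} eq = cong suc (unique-lookup-injective xs! eq)

-- Sending a position in `xs` to the position of the same entry in `ys` is an injection.
unique-⊆⇒length≤ : {xs ys : List A} → Unique xs → xs ⊆ ys → length xs ≤ length ys
unique-⊆⇒length≤ {xs = xs} xs! xs⊆ys =
  Fin.injective⇒≤ {f = λ i → Any.index (xs⊆ys (∈-lookup {xs = xs} i))} λ {i} {j} eq →
    unique-lookup-injective xs!
      (index-injective (setoid _) (xs⊆ys (∈-lookup i)) (xs⊆ys (∈-lookup j)) eq)

-- The number of elements of `S` below `x`. It lets a subset serve as a palette of `∣ S ∣` colours.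
rank : (S : Subset n) → ∀ {x} → x ∈ₛ S → Fin ∣ S ∣
rank (inside ∷ S)  here        = zero
rank (inside ∷ S)  (there x∈S) = suc (rank S x∈S)
rank (outside ∷ S) (there x∈S) = rank S x∈S

rank-injective : (S : Subset n) → ∀ {x y} (x∈S : x ∈ₛ S) (y∈S : y ∈ₛ S) →
                 rank S x∈S ≡ rank S y∈S → x ≡ y
rank-injective (inside ∷ S)  here        here        _  = refl
rank-injective (inside ∷ S)  (there x∈S) (there y∈S) eq =
  cong suc (rank-injective S x∈S y∈S (Fin.suc-injective eq))
rank-injective (outside ∷ S) (there x∈S) (there y∈S) eq =
  cong suc (rank-injective S x∈S y∈S eq)

fromList : List (Fin n) → Subset n
fromList xs = tabulate (λ x → does (DecMembership._∈?_ Fin._≟_ x xs))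

∈-fromList⁺ : ∀ {xs : List (Fin n)} {x} → x ∈ xs → x ∈ₛ fromList xs
∈-fromList⁺ {xs = xs} {x} x∈xs = Vec.lookup⇒[]= x _
  (trans (Vec.lookup∘tabulate _ x) (dec-true (DecMembership._∈?_ Fin._≟_ x xs) x∈xs))

∈-fromList⁻ : ∀ {xs : List (Fin n)} {x} → x ∈ₛ fromList xs → x ∈ xs
∈-fromList⁻ {xs = xs} {x} x∈S with DecMembership._∈?_ Fin._≟_ x xs in eq
... | yes x∈xs = x∈xs
... | no  x∉xs = contradiction
  (trans (sym (cong does eq)) (trans (sym (Vec.lookup∘tabulate _ x)) (Vec.[]=⇒lookup x∈S)))
  λ ()

length≤∣fromList∣ : ∀ {xs : List (Fin n)} → Unique xs → length xs ≤ ∣ fromList xs ∣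
length≤∣fromList∣ {xs = xs} xs! =
  Fin.injective⇒≤ {f = λ i → rank (fromList xs) (∈-fromList⁺ (∈-lookup {xs = xs} i))}
    (unique-lookup-injective xs! ∘ rank-injective (fromList xs) _ _)

allPairs-symmetric : ∀ {R : Rel A p} → Symmetric R → ∀ {xs} → AllPairs R xs →
                     ∀ {x y} → x ∈ xs → y ∈ xs → x ≢ y → R x y
allPairs-symmetric R-sym _            (here refl) (here refl) x≢y = contradiction refl x≢y
allPairs-symmetric R-sym (all ∷ _)    (here refl) (there y∈)  _   = All.lookup all y∈
allPairs-symmetric R-sym (all ∷ _)    (there x∈)  (here refl) _   = R-sym (All.lookup all x∈)
allPairs-symmetric R-sym (_ ∷ pairs)  (there x∈)  (there y∈)  x≢y =
  allPairs-symmetric R-sym pairs x∈ y∈ x≢y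

length-allFin : ∀ n → length (allFin n) ≡ n
length-allFin n = length-tabulate {n = n} id

-- Turán's theorem for graphs of bounded independence number.

-- Bounds the independence number without having to exhibit its value.
IndependenceAtMost : ℕ → Graph n → Set
IndependenceAtMost a G = ∀ S → Independent G S → ∣ S ∣ ≤ a

module _ (G : Graph n) where
  open Graph G

  -- The filter repeats that of `edgeCount`, so the length of this list is `edgeCount G` by
  -- computation.
  edges : List (Fin n × Fin n)
  edges = filter (λ { (x , y) → x Fin.<? y ×-dec x ~? y })
                 (cartesianProduct (allFin n) (allFin n))

  ∈-edges⁺ : ∀ {x y} → x Fin.< y → x ~ y → (x , y) ∈ edges
  ∈-edges⁺ x<y x~y = ∈-filter⁺ (λ { (x , y) → x Fin.<? y ×-dec x ~? y })
    (∈-cartesianProduct⁺ (∈-allFin _) (∈-allFin _)) (x<y , x~y)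

  ∈-edges⁻ : ∀ {x y} → (x , y) ∈ edges → x Fin.< y × x ~ y
  ∈-edges⁻ xy∈ = proj₂ (∈-filter⁻ (λ { (x , y) → x Fin.<? y ×-dec x ~? y })
    {xs = cartesianProduct (allFin n) (allFin n)} xy∈)

  edges-unique : Unique edges
  edges-unique = Unique.filter⁺ (λ { (x , y) → x Fin.<? y ×-dec x ~? y })
    (Unique.cartesianProduct⁺ (Unique.allFin⁺ n) (Unique.allFin⁺ n))

  private
    -- Equality is included to make the relation reflexive; pairwise unrelated entries are then
    -- distinct as well as non-adjacent.
    _≈_ : Rel (Fin n) _
    x ≈ y = x ≡ y ⊎ x ~ y

    _≈?_ : Decidable _≈_
    x ≈? y = x Fin.≟ y ⊎-dec x ~? y

  -- The degree sum counts the related ordered pairs: the `n` diagonal ones, and every edge in each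
  -- of its two orders.
  sum-degree≤ : sum (map (degree _≈?_ (inj₁ refl) (allFin n)) (allFin n)) ≤ 2 * edgeCount G + n
  sum-degree≤ = begin
    sum (map (degree _≈?_ (inj₁ refl) (allFin n)) (allFin n))
      ≡⟨ sum-degree _≈?_ (inj₁ refl) (allFin n) (allFin n) ⟩
    length (filter ≈²? (cartesianProduct (allFin n) (allFin n)))
      ≤⟨ unique-⊆⇒length≤
           (Unique.filter⁺ ≈²? (Unique.cartesianProduct⁺ (Unique.allFin⁺ n) (Unique.allFin⁺ n)))
           covered ⟩
    length (map (λ x → x , x) (allFin n) ++ edges ++ map swap edges)
      ≡⟨ length-++ (map (λ x → x , x) (allFin n)) ⟩
    length (map (λ x → x , x) (allFin n)) + length (edges ++ map swap edges)
      ≡⟨ cong₂ _+_ (trans (length-map _ (allFin n)) (length-allFin n))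
                   (trans (length-++ edges) (cong (_+_ (edgeCount G)) (length-map swap edges))) ⟩
    n + (edgeCount G + edgeCount G)
      ≡⟨ eq n (edgeCount G) ⟩
    2 * edgeCount G + n ∎
    where
    open ≤-Reasoning
    eq : ∀ n e → n + (e + e) ≡ 2 * e + n
    eq = solve-∀
    ≈²? : Unary.Decidable (λ ((x , y) : Fin n × Fin n) → x ≈ y)
    ≈²? (x , y) = x ≈? y
    covered : filter ≈²? (cartesianProduct (allFin n) (allFin n)) ⊆
              map (λ x → x , x) (allFin n) ++ edges ++ map swap edges
    covered {x , y} xy∈ with proj₂ (∈-filter⁻ ≈²? {xs = cartesianProduct (allFin n) (allFin n)} xy∈)
    ... | inj₁ refl = ∈-++⁺ˡ (∈-map⁺ _ (∈-allFin x))
    ... | inj₂ x~y with Fin.<-cmp x y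
    ...   | tri< x<y _ _  = ∈-++⁺ʳ (map _ (allFin n)) (∈-++⁺ˡ (∈-edges⁺ x<y x~y))
    ...   | tri≈ _ x≡y _  = contradiction x~y (irrefl x≡y)
    ...   | tri> _ _ y<x  = ∈-++⁺ʳ (map _ (allFin n))
            (∈-++⁺ʳ edges (∈-map⁺ swap (∈-edges⁺ y<x (~-sym x~y))))

  -- The greedy independent list has at most `a` entries, which turns its degree-sum inequality into
  -- e ≥ n²/(2a) - n/2 cleared of denominators.
  turán : IndependenceAtMost a G → n * n ≤ a * (2 * edgeCount G + n)
  turán {a} α≤a
    with ys , _ , ys-indep , bound ← greedyIndependent _≈?_ (inj₁ refl) (allFin n) = begin
    n * n                              ≡⟨ cong₂ _*_ (length-allFin n) (length-allFin n) ⟨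
    length (allFin n) * length (allFin n) ≤⟨ bound ⟩
    length ys * _                      ≤⟨ *-mono-≤ ys≤a sum-degree≤ ⟩
    a * (2 * edgeCount G + n)          ∎
    where
    open ≤-Reasoning
    ys! : Unique ys
    ys! = AllPairs.map (λ ¬≈ eq → ¬≈ (inj₁ eq)) ys-indep
    independent : Independent G (fromList ys)
    independent x∈ y∈ x~y = allPairs-symmetric {R = λ x y → ¬ x ~ y} (λ ¬xy yx → ¬xy (~-sym yx))
      (AllPairs.map (λ ¬≈ xy → ¬≈ (inj₂ xy)) ys-indep)
      (∈-fromList⁻ x∈) (∈-fromList⁻ y∈) (λ x≡y → irrefl x≡y x~y) x~y
    ys≤a : length ys ≤ a
    ys≤a = ≤-trans (length≤∣fromList∣ ys!) (α≤a (fromList ys) independent)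

-- Extremal values, colourings and girth by exhaustive search.

least : ∀ {P : ℕ → Set p} → Unary.Decidable P → ∀ {n} → P n → ∃ (IsMinimum P)
least {P = P} P? {n} = <-rec (λ n → P n → ∃ (IsMinimum P)) step n
  where
  step : ∀ n → (∀ {k} → k < n → P k → ∃ (IsMinimum P)) → P n → ∃ (IsMinimum P)
  step n rec Pn with anyUpTo? P? n
  ... | yes (k , k<n , Pk) = rec k<n Pk
  ... | no  none           = n , Pn , λ d Pd → ≮⇒≥ (λ d<n → none (d , d<n , Pd))

greatest : ∀ {P : ℕ → Set p} → Unary.Decidable P → P 0 → ∀ b → (∀ d → P d → d ≤ b) →
           ∃ (IsMaximum P)
greatest P? P0 zero    bound = 0 , P0 , bound
greatest {P = P} P? P0 (suc b) bound with P? (suc b)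
... | yes Pb = suc b , Pb , bound
... | no ¬Pb = greatest P? P0 b λ d Pd →
  s≤s⁻¹ (≤∧≢⇒< (bound d Pd) (λ { refl → ¬Pb Pd }))

independent? : (G : Graph n) → Unary.Decidable (Independent G)
independent? G S = map′ (λ f {x} {y} → f x y) (λ f x y → f)
  (Fin.all? λ x → Fin.all? λ y →
    (x Subset.∈? S) →-dec (y Subset.∈? S) →-dec ¬? (Graph._~?_ G x y))

independenceNumber≤ : (G : Graph n) → IndependenceAtMost a G →
                      ∃[ α ] IndependenceNumber G α × α ≤ a
independenceNumber≤ {n} G α≤a
  with greatest (λ s → Subset.anySubset? λ S → independent? G S ×-dec (∣ S ∣ ≟ s))
         (∅ , (λ x∈∅ → contradiction x∈∅ Subset.∉⊥) , Subset.∣⊥∣≡0 n)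
         n (λ { _ (S , _ , refl) → Subset.∣p∣≤n S })
... | α , isMax@((S , indep , refl) , _) = α , isMax , α≤a S indep

-- Functions between finite sets are enumerated through their codes in a finite type. Decoding
-- recovers a function only pointwise, so `P` has to respect `≗`.
anyFunction? : ∀ {P : (Fin m → Fin n) → Set p} → (∀ {f g} → f ≗ g → P f → P g) →
               Unary.Decidable P → Dec (∃ P)
anyFunction? respects P? = map′
  (λ (i , Pi) → finToFun i , Pi)
  (λ (f , Pf) → funToFin f , respects (sym ∘ Fin.finToFun-funToFin f) Pf)
  (Fin.any? (P? ∘ finToFun))

colourable? : (G : Graph n) → Unary.Decidable (Colourable G)
colourable? G c = anyFunction? respects λ f → map′ (λ p {x} {y} → p x y) (λ p x y → p)
  (Fin.all? λ x → Fin.all? λ y → Graph._~?_ G x y →-dec ¬? (f x Fin.≟ f y))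
  where
  respects : ∀ {f g : Fin _ → Fin c} → f ≗ g → Proper G f → Proper G g
  respects f≗g proper {x} {y} x~y gx≡gy = proper x~y (trans (f≗g x) (trans gx≡gy (sym (f≗g y))))

colourable-mono : (G : Graph n) → c ≤ h → Colourable G c → Colourable G h
colourable-mono G c≤h (f , proper) = (λ x → inject≤ (f x) c≤h) ,
  λ x~y eq → proper x~y (Fin.inject≤-injective c≤h c≤h _ _ eq)

chromaticNumber : (G : Graph n) → ∃ (ChromaticNumber G)
-- The search starts from the colouring that gives every vertex its own colour.
chromaticNumber G = least (colourable? G) (id , λ x~y x≡y → Graph.irrefl G x≡y x~y)

_↝?_ : ∀ {ℓ} → Decidable (_↝_ {ℓ})
i ↝? j = (toℕ j ≟ suc (toℕ i)) ⊎-dec ((suc (toℕ i) ≟ _) ×-dec (toℕ j ≟ 0))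

cycleOfLength? : (G : Graph n) → Unary.Decidable (λ ℓ → Σ[ C ∈ Cycle G ] len C ≡ ℓ)
cycleOfLength? G ℓ = map′
  (λ { (3≤ , f , inj , adj) → record
         { len = ℓ ; 3≤len = 3≤ ; vertex = f ; injective = inj _ _ ; adjacent = adj _ _ } , refl })
  (λ { (C , refl) → Cycle.3≤len C , Cycle.vertex C ,
                    (λ _ _ → Cycle.injective C) , (λ _ _ → Cycle.adjacent C) })
  ((3 ≤? ℓ) ×-dec anyFunction? respects λ f →
    (Fin.all? λ i → Fin.all? λ j → (f i Fin.≟ f j) →-dec (i Fin.≟ j)) ×-dec
    (Fin.all? λ i → Fin.all? λ j → (i ↝? j) →-dec Graph._~?_ G (f i) (f j)))
  where
  IsCycle : (Fin ℓ → Fin _) → Set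
  IsCycle f = (∀ i j → f i ≡ f j → i ≡ j) × (∀ i j → i ↝ j → Adj G (f i) (f j))
  respects : ∀ {f g} → f ≗ g → IsCycle f → IsCycle g
  respects f≗g (inj , adj) =
    (λ i j eq → inj i j (trans (f≗g i) (trans eq (sym (f≗g j))))) ,
    (λ i j i↝j → subst₂ (Adj G) (f≗g i) (f≗g j) (adj i j i↝j))

shortCycle? : (G : Graph n) → ∀ r → Dec (Σ[ C ∈ Cycle G ] len C < r)
shortCycle? G r = map′ (λ { (_ , ℓ<r , C , refl) → C , ℓ<r }) (λ (C , ℓ<r) → len C , ℓ<r , C , refl)
  (anyUpTo? (cycleOfLength? G) r)

-- The vertices of a cycle are distinct, so no cycle is longer than `n`; finding none of length
-- below `suc n` proves the graph acyclic.
girth : (G : Graph n) → ∃ (Girth G)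
girth {n} G with shortCycle? G (suc n)
... | yes (C , _) = let g , isMin = least (cycleOfLength? G) (C , refl) in [ g ] , isMin
... | no none = ⊤⁺ , λ C → none (C , s≤s (Fin.injective⇒≤ (Cycle.injective C)))

-- Without short cycles the girth of `H` is at least `r`, so its chromatic number is among the
-- values of which `h` is the maximum. An optimal colouring is then viewed in the larger palette.
highGirth⇒colourable : {K : Graph n} → HighGirthChromatic r K h → (H : Graph n) → H ⊆ᴳ K →
                       ¬ (Σ[ C ∈ Cycle H ] len C < r) → Colourable H h
highGirth⇒colourable {r = r} (_ , maximal) H H⊆K no-short =
  colourable-mono H (maximal χ
      (_ , H , H⊆K , (proj₁ (girth H) , proj₂ (girth H) , r≤g _ (proj₂ (girth H))) , isChromatic))
    (proj₁ isChromatic)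
  where
  χ = proj₁ (chromaticNumber H)
  isChromatic = proj₂ (chromaticNumber H)
  r≤g : ∀ g → Girth H g → [ r ] ≤⁺ g
  r≤g ⊤⁺    _                 = [ r ] ≤⊤⁺
  r≤g [ g ] ((C , refl) , _)  = [ ≮⇒≥ (λ short → no-short (C , short)) ]

-- Recolouring by `η` and the independence number of P_η.

module _ (K : Graph n) (K-chromatic : ChromaticNumber K m)
         (φ : Fin n → Fin m) (φ-proper : Proper K φ) where

  -- Vertices with class outside `S` keep their `φ`-colour, renumbered by `rank` in the complement
  -- and placed in a block disjoint from the `a` colours of `η`. A clash in the first block would be
  -- an edge of P_η inside `S`, one in the second an edge on which `φ` is constant. Minimality of
  -- `m` then bounds the number of colours from below.
  monochromatic-independence : (η : Fin n → Fin a) →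
    IndependenceAtMost a (monochromaticGraph K φ φ-proper η)
  monochromatic-independence {a} η S independent =
    +-cancelʳ-≤ (m ∸ ∣ S ∣) ∣ S ∣ a (begin
      ∣ S ∣ + (m ∸ ∣ S ∣)  ≡⟨ m+[n∸m]≡n (Subset.∣p∣≤n S) ⟩
      m                    ≤⟨ proj₂ K-chromatic (a + ∣ ∁ S ∣) (join a ∣ ∁ S ∣ ∘ colour , proper) ⟩
      a + ∣ ∁ S ∣          ≡⟨ cong (_+_ a) (Subset.∣∁p∣≡n∸∣p∣ S) ⟩
      a + (m ∸ ∣ S ∣)      ∎)
    where
    open ≤-Reasoning
    colour : Fin n → Fin a ⊎ Fin ∣ ∁ S ∣
    colour x with φ x Subset.∈? S
    ... | yes _   = inj₁ (η x)
    ... | no  φx∉ = inj₂ (rank (∁ S) (Subset.x∉p⇒x∈∁p φx∉))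
    colour-proper : ∀ {x y} → Adj K x y → colour x ≢ colour y
    colour-proper {x} {y} x~y with φ x Subset.∈? S | φ y Subset.∈? S
    ... | yes φx∈ | yes φy∈ =
      λ eq → independent φx∈ φy∈ (x , y , x~y , refl , refl , inj₁-injective eq)
    ... | yes _   | no  _   = λ ()
    ... | no  _   | yes _   = λ ()
    ... | no  _   | no  _   = λ eq → φ-proper x~y (rank-injective (∁ S) _ _ (inj₂-injective eq))
    proper : Proper K (join a ∣ ∁ S ∣ ∘ colour)
    proper {x} {y} x~y eq = colour-proper x~y (trans (sym (Fin.splitAt-join a _ (colour x)))
      (trans (cong (splitAt a) eq) (Fin.splitAt-join a _ (colour y))))

-- Deleting the edges whose colour pair lies in `T`.

avoiding : Graph n → (Fin n → Fin m) → Graph m → Graph n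
avoiding K φ T = record
  { _~_    = λ x y → x K.~ y × ¬ φ x T.~ φ y
  ; _~?_   = λ x y → (x K.~? y) ×-dec ¬? (φ x T.~? φ y)
  ; ~-sym  = λ (x~y , ¬T) → K.~-sym x~y , ¬T ∘ T.~-sym
  ; irrefl = λ eq (x~y , _) → K.irrefl eq x~y
  }
  where
  module K = Graph K
  module T = Graph T

module _ (K : Graph n) (φ : Fin n → Fin m) (T : Graph m) where

  avoiding-⊆ : avoiding K φ T ⊆ᴳ K
  avoiding-⊆ = record { incl = id ; injective = id ; edges = proj₁ }

  forget : Cycle (avoiding K φ T) → Cycle K
  forget C = record
    { len = len C ; 3≤len = 3≤len ; vertex = vertex ; injective = injective ; adjacent = proj₁ ∘ adjacent }
    where open Cycle C

  forget-avoids : ∀ C → ¬ Meets (Adj T) (Π φ (forget C))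
  forget-avoids C (_ , _ , Tij , _ , _ , fwd (_ , _ , i↝j , refl , refl) , refl , refl) =
    proj₂ (Cycle.adjacent C i↝j) Tij
  forget-avoids C (_ , _ , Tij , _ , _ , bwd (_ , _ , i↝j , refl , refl) , refl , refl) =
    proj₂ (Cycle.adjacent C i↝j) (Graph.~-sym T Tij)

module _ (K : Graph n) (K-chromatic : ChromaticNumber K m)
         (highGirth : HighGirthChromatic r K h) (h≤a : h ≤ a)
         (φ : Fin n → Fin m) (φ-proper : Proper K φ) where

  -- Every edge of `K` between classes in `S` survives the deletion, since `S` is independent in
  -- `T`, so an `a`-colouring `η` of the remaining graph separates its ends. Thus `S` is independent
  -- in P_η. The hypothesis is on the remaining graph so as to serve both transversals and maximal
  -- packings.
  avoiding-independence : ∀ T → ¬ (Σ[ C ∈ Cycle (avoiding K φ T) ] len C < r) → IndependenceAtMost a T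
  avoiding-independence T no-short S independent =
    monochromatic-independence K K-chromatic φ φ-proper η S P-independent
    where
    H : Graph n
    H = avoiding K φ T
    colouring : Colourable H a
    colouring = colourable-mono H h≤a (highGirth⇒colourable highGirth H (avoiding-⊆ K φ T) no-short)
    η : Fin n → Fin a
    η = proj₁ colouring
    P-independent : Independent (monochromaticGraph K φ φ-proper η) S
    P-independent φx∈ φy∈ (x , y , x~y , refl , refl , ηx≡ηy) =
      proj₂ colouring (x~y , independent φx∈ φy∈) ηx≡ηy

  transversal-independence : ∀ T → (∀ (C : Cycle K) → len C < r → Meets (Adj T) (Π φ C)) →
                             IndependenceAtMost a T
  transversal-independence T meets = avoiding-independence T λ (C , short) →
    forget-avoids K φ T C (meets (forget K φ T C) short)

-- Listing the colour pairs of a cycle.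

-- The cyclic successor as a function, so that the edges of a cycle can be listed by their starting
-- index.
next : ∀ {ℓ} → Fin ℓ → Fin ℓ
next {suc ℓ} i with suc (toℕ i) <? suc ℓ
... | yes i+1<ℓ = fromℕ< i+1<ℓ
... | no  _     = zero

↝⇒next : ∀ {ℓ} {i j : Fin ℓ} → i ↝ j → next i ≡ j
↝⇒next {suc ℓ} {i} {j} i↝j with suc (toℕ i) <? suc ℓ | i↝j
... | yes i+1<ℓ | inj₁ j≡i+1       = Fin.toℕ-injective (trans (Fin.toℕ-fromℕ< i+1<ℓ) (sym j≡i+1))
... | yes i+1<ℓ | inj₂ (i+1≡ℓ , _) = contradiction i+1<ℓ (<-irrefl i+1≡ℓ)
... | no  i+1≮ℓ | inj₁ j≡i+1       = contradiction (subst (_< suc ℓ) j≡i+1 (Fin.toℕ<n j)) i+1≮ℓ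
... | no  _     | inj₂ (_ , j≡0)   = Fin.toℕ-injective (sym j≡0)

-- A normal form for unordered pairs of distinct elements, agreeing with the order used in `edges`.
sortPair : Fin n → Fin n → Fin n × Fin n
sortPair x y with x Fin.<? y
... | yes _ = x , y
... | no  _ = y , x

sortPair-< : ∀ {x y : Fin n} → x Fin.< y → sortPair x y ≡ (x , y)
sortPair-< {x = x} {y} x<y with x Fin.<? y
... | yes _   = refl
... | no  x≮y = contradiction x<y x≮y

sortPair-> : ∀ {x y : Fin n} → x Fin.< y → sortPair y x ≡ (x , y)
sortPair-> {x = x} {y} x<y with y Fin.<? x
... | yes y<x = contradiction y<x (<-asym x<y)
... | no  _   = refl

module _ (K : Graph n) (φ : Fin n → Fin m) where

  -- One entry per edge of the cycle. Repetitions are kept, which makes the length exactly `len C`.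
  colourPairs : Cycle K → List (Fin m × Fin m)
  colourPairs C = map (λ i → sortPair (φ (vertex i)) (φ (vertex (next i)))) (allFin (len C))
    where open Cycle C using (vertex)

  length-colourPairs : ∀ C → length (colourPairs C) ≡ len C
  length-colourPairs C = trans (length-map _ (allFin (len C))) (length-allFin (len C))

  ∈-colourPairs : ∀ C {i j} → i Fin.< j → Π φ C i j → (i , j) ∈ colourPairs C
  ∈-colourPairs C φx<φy (_ , _ , fwd (s , _ , s↝t , refl , refl) , refl , refl)
    rewrite sym (↝⇒next s↝t) =
    subst (_∈ colourPairs C) (sortPair-< φx<φy) (∈-map⁺ _ (∈-allFin s))
  ∈-colourPairs C φy<φx (_ , _ , bwd (s , _ , s↝t , refl , refl) , refl , refl)
    rewrite sym (↝⇒next s↝t) =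
    subst (_∈ colourPairs C) (sortPair-> φy<φx) (∈-map⁺ _ (∈-allFin s))

  Π? : ∀ (C : Cycle K) → Decidable (Π φ C)
  Π? C i j = Fin.any? λ x → Fin.any? λ y →
    cycleEdge? x y ×-dec (φ x Fin.≟ i) ×-dec (φ y Fin.≟ j)
    where
    open Cycle C using (vertex)
    directed? : Decidable (λ x y → ∃₂ λ i j → i ↝ j × vertex i ≡ x × vertex j ≡ y)
    directed? x y = Fin.any? λ i → Fin.any? λ j →
      (i ↝? j) ×-dec (vertex i Fin.≟ x) ×-dec (vertex j Fin.≟ y)
    cycleEdge? : Decidable (CycleEdge C)
    cycleEdge? x y = map′ (λ { (inj₁ xy) → fwd xy ; (inj₂ yx) → bwd yx })
      (λ { (fwd xy) → inj₁ xy ; (bwd yx) → inj₂ yx }) (directed? x y ⊎-dec directed? y x)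

  Π-sym : ∀ (C : Cycle K) → Symmetric (Π φ C)
  Π-sym C (x , y , xy , φx , φy) = y , x , SymClosure.symmetric _ xy , φy , φx

  Π-irrefl : Proper K φ → ∀ (C : Cycle K) {i} → ¬ Π φ C i i
  Π-irrefl proper C (_ , _ , fwd (_ , _ , s↝t , refl , refl) , eq₁ , eq₂) =
    proper (Cycle.adjacent C s↝t) (trans eq₁ (sym eq₂))
  Π-irrefl proper C (_ , _ , bwd (_ , _ , s↝t , refl , refl) , eq₁ , eq₂) =
    proper (Cycle.adjacent C s↝t) (trans eq₂ (sym eq₁))

  -- A common edge would project under `φ` to a common colour pair.
  disjoint-cycleEdges : ∀ (C D : Cycle K) → Disjoint (Π φ C) (Π φ D) → Disjoint (CycleEdge C) (CycleEdge D)
  disjoint-cycleEdges C D disjoint (x , y , xy∈C , xy∈D) =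
    disjoint (φ x , φ y , (x , y , xy∈C , refl , refl) , (x , y , xy∈D , refl , refl))

-- Packings of short cycles with disjoint colour pairs.

module _ (K : Graph n) (φ : Fin n → Fin m) (proper : Proper K φ) where

  ⋃Π : List (Cycle K) → Graph m
  ⋃Π M = record
    { _~_    = λ i j → Any (λ (C : Cycle K) → Π φ C i j) M
    ; _~?_   = λ i j → Any.any? (λ (C : Cycle K) → Π? K φ C i j) M
    ; ~-sym  = Any.map (λ {C} → Π-sym K φ C)
    ; irrefl = λ { refl any → let C , _ , Πii = find any in Π-irrefl K φ proper C Πii }
    }

  -- Every edge of the union occurs in the concatenated colour-pair lists, to which each cycle
  -- contributes at most `b` entries.
  edgeCount-⋃Π : ∀ {M} → All (λ C → len C ≤ b) M → edgeCount (⋃Π M) ≤ length M * b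
  edgeCount-⋃Π {b} {M} short = ≤-trans
    (unique-⊆⇒length≤ (edges-unique (⋃Π M)) covered) (length≤ short)
    where
    covered : edges (⋃Π M) ⊆ concatMap (colourPairs K φ) M
    covered xy∈ with x<y , any ← ∈-edges⁻ (⋃Π M) xy∈ =
      ∈-concatMap⁺ (colourPairs K φ) (Any.map (λ {C : Cycle K} → ∈-colourPairs K φ C x<y) any)
    length≤ : ∀ {M} → All (λ C → len C ≤ b) M → length (concatMap (colourPairs K φ) M) ≤ length M * b
    length≤ [] = z≤n
    length≤ {C ∷ M} (C≤b ∷ M≤b) rewrite length-++ (colourPairs K φ C) {concatMap (colourPairs K φ) M} =
      +-mono-≤ (≤-trans (≤-reflexive (length-colourPairs K φ C)) C≤b) (length≤ M≤b)

  record Packing (r : ℕ) : Set where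
    constructor packing
    field
      cycles   : List (Cycle K)
      short    : All (λ C → len C < r) cycles
      disjoint : AllPairs (λ C D → Disjoint (Π φ C) (Π φ D)) cycles

  open Packing

  -- Cycles of the reduced graph are the cycles of `K` whose colour pairs miss all those in use, so
  -- none can be added. This is the form that `avoiding-independence` takes as hypothesis.
  Maximal : Packing r → Set
  Maximal {r} M = ¬ (Σ[ C ∈ Cycle (avoiding K φ (⋃Π (cycles M))) ] len C < r)

  -- Cycles are added greedily. Prescribing the number `N` of rounds makes the recursion structural;
  -- it either completes them or stops at a maximal packing.
  packing-of-size : ∀ N → Σ[ M ∈ Packing r ] (length (cycles M) ≡ N ⊎ Maximal M)
  packing-of-size zero = packing [] [] [] , inj₁ refl
  packing-of-size {r} (suc N) with packing-of-size {r} N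
  ... | M , inj₂ maximal = M , inj₂ maximal
  ... | M , inj₁ size with shortCycle? (avoiding K φ (⋃Π (cycles M))) r
  ...   | no  none          = M , inj₂ none
  ...   | yes (C , C<r) = record
            { cycles   = forget K φ (⋃Π (cycles M)) C ∷ cycles M
            ; short    = C<r ∷ short M
            ; disjoint = All.tabulate (λ D∈M (i , j , ij∈C , ij∈D) →
                           forget-avoids K φ (⋃Π (cycles M)) C (i , j , lose D∈M ij∈D , ij∈C)) ∷ disjoint M
            } , inj₁ (cong suc size)

module _ (K : Graph n) (K-chromatic : ChromaticNumber K m)
         (highGirth : HighGirthChromatic (suc b) K h) (h≤a : h ≤ a)
         (φ : Fin n → Fin m) (φ-proper : Proper K φ) where

  -- A packing of m² cycles already meets the bound, so it need not be maximal.
  large-packing : .{{_ : NonZero a}} .{{_ : NonZero b}} →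
    Σ[ M ∈ Packing K φ φ-proper (suc b) ]
      m * m ≤ a * (2 * (length (Packing.cycles M) * b) + m)
  large-packing with packing-of-size K φ φ-proper {suc b} (m * m)
  ... | M , inj₁ size = M , (begin
    m * m                        ≤⟨ m≤m*n (m * m) b ⟩
    m * m * b                    ≤⟨ m≤n*m (m * m * b) 2 ⟩
    2 * (m * m * b)              ≤⟨ m≤m+n _ m ⟩
    2 * (m * m * b) + m          ≤⟨ m≤n*m _ a ⟩
    a * (2 * (m * m * b) + m)    ≡⟨ cong (λ N → a * (2 * (N * b) + m)) size ⟨
    a * (2 * (length (Packing.cycles M) * b) + m) ∎)
    where open ≤-Reasoning
  ... | M , inj₂ maximal = M , ≤-trans
    (turán T (avoiding-independence K K-chromatic highGirth h≤a φ φ-proper T maximal))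
    (*-monoʳ-≤ a (+-monoˡ-≤ m (*-monoʳ-≤ 2
      -- Length below `suc b` means at most `b`, which is where the factor r - 1 comes from.
      (edgeCount-⋃Π K φ φ-proper (All.map s≤s⁻¹ (Packing.short M))))))
    where
    T : Graph m
    T = ⋃Π K φ φ-proper (Packing.cycles M)

-- From natural-number inequalities to rational bounds.

-- Rationals are stored in lowest terms; passing to unnormalised fractions reduces comparisons to
-- cross-multiplication of integers.
toℚᵘ-/ : ∀ i d .{{_ : NonZero d}} → ℚ.toℚᵘ (i / d) ℚᵘ.≃ i ℚᵘ./ d
toℚᵘ-/ i (suc d) = ℚ.toℚᵘ-fromℚᵘ (ℚᵘ.mkℚᵘ i d)

-- The hypothesis, cross-multiplied, says m²/(2a) ≤ e + m/2; subtracting m/2 gives the claim.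
turánBound≤ : ∀ m a e .{{_ : NonZero a}} → m * m ≤ a * (2 * e + m) → turánBound m a ℚ.≤ + e / 1
turánBound≤ m a@(suc _) e bound = begin
  q ℚ.- + m / 2                        ≤⟨ ℚ.+-monoˡ-≤ (ℚ.- (+ m / 2)) q≤ ⟩
  (+ e / 1 ℚ.+ + m / 2) ℚ.- + m / 2    ≡⟨ ℚ.+-assoc (+ e / 1) (+ m / 2) (ℚ.- (+ m / 2)) ⟩
  + e / 1 ℚ.+ (+ m / 2 ℚ.- + m / 2)    ≡⟨ cong (ℚ._+_ (+ e / 1)) (ℚ.+-inverseʳ (+ m / 2)) ⟩
  + e / 1 ℚ.+ ℚ.0ℚ                     ≡⟨ ℚ.+-identityʳ (+ e / 1) ⟩
  + e / 1                              ∎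
  where
  open ℚ.≤-Reasoning
  q : ℚ.ℚ
  q = + (m * m) / (2 * a)
  integral : + (m * m) ℤ.* + 2 ℤ.≤ (+ e ℤ.* + 2 ℤ.+ + m ℤ.* + 1) ℤ.* + (2 * a)
  integral = subst₂ ℤ._≤_ (ℤ.pos-* (m * m) 2) (trans (ℤ.pos-* (e * 2 + m * 1) (2 * a))
      (cong (ℤ._* + (2 * a))
        (trans (ℤ.pos-+ (e * 2) (m * 1)) (cong₂ ℤ._+_ (ℤ.pos-* e 2) (ℤ.pos-* m 1)))))
    (ℤ.+≤+ (≤-trans (*-monoˡ-≤ 2 bound) (≤-reflexive (eq a e m))))
    where
    eq : ∀ a e m → a * (2 * e + m) * 2 ≡ (e * 2 + m * 1) * (2 * a)
    eq = solve-∀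
  q≤ : q ℚ.≤ + e / 1 ℚ.+ + m / 2
  q≤ = ℚ.toℚᵘ-cancel-≤ (ℚᵘ.≤-respˡ-≃ (ℚᵘ.≃-sym (toℚᵘ-/ (+ (m * m)) (2 * a)))
    (ℚᵘ.≤-respʳ-≃ (ℚᵘ.≃-sym (ℚᵘ.≃-trans (ℚ.toℚᵘ-homo-+ (+ e / 1) (+ m / 2))
        (ℚᵘ.+-cong (toℚᵘ-/ (+ e) 1) (toℚᵘ-/ (+ m) 2))))
      (ℚᵘ.*≤* integral)))

1/b*[N*b]≡N : ∀ N b .{{_ : NonZero b}} → (+ 1 / b) ℚ.* (+ (N * b) / 1) ≡ + N / 1
1/b*[N*b]≡N N b@(suc _) = ℚ.toℚᵘ-injective (begin
  ℚ.toℚᵘ ((+ 1 / b) ℚ.* (+ (N * b) / 1))         ≈⟨ ℚ.toℚᵘ-homo-* (+ 1 / b) (+ (N * b) / 1) ⟩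
  ℚ.toℚᵘ (+ 1 / b) ℚᵘ.* ℚ.toℚᵘ (+ (N * b) / 1)   ≈⟨ ℚᵘ.*-cong (toℚᵘ-/ (+ 1) b) (toℚᵘ-/ (+ (N * b)) 1) ⟩
  (+ 1 ℚᵘ./ b) ℚᵘ.* (+ (N * b) ℚᵘ./ 1)           ≈⟨ ℚᵘ.*≡* cross ⟩
  + N ℚᵘ./ 1                                     ≈⟨ toℚᵘ-/ (+ N) 1 ⟨
  ℚ.toℚᵘ (+ N / 1)                               ∎)
  where
  open ℚᵘ.≃-Reasoning
  cross : + 1 ℤ.* + (N * b) ℤ.* + 1 ≡ + N ℤ.* + (b * 1)
  cross = trans (ℤ.*-identityʳ _) (trans (ℤ.*-identityˡ _)
    (trans (cong (λ z → + (N * z)) (sym (*-identityʳ b))) (ℤ.pos-* N (b * 1))))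

1/b*p≤ : ∀ N b .{{_ : NonZero b}} {p} → p ℚ.≤ + (N * b) / 1 → (+ 1 / b) ℚ.* p ℚ.≤ + N / 1
1/b*p≤ N b p≤ = subst (ℚ._≤_ _) (1/b*[N*b]≡N N b)
  (ℚ.*-monoˡ-≤-nonNeg (+ 1 / b) {{ℚ.normalize-nonNeg 1 b}} p≤)

theorem1p8 :
    ∀ (r k : ℕ) (4≤r : 4 ≤ r) (2≤k : 2 ≤ k) →
    ∀ {n m : ℕ} (K : Graph n) → ChromaticNumber K m →
    (∃[ h ] (HighGirthChromatic r K h × h < k)) →
    ∀ (φ : Fin n → Fin m) (φ-proper : Proper K φ) → Surjective _≡_ _≡_ φ →
    let a = k ∸ 1
        instance
          a≢0 : NonZero (k ∸ 1)
          a≢0 = pred-nonZero 2≤k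
          r-1≢0 : NonZero (r ∸ 1)
          r-1≢0 = pred-nonZero 4≤r
    in
    (∀ (η : Fin n → Fin a) →
       let P = monochromaticGraph K φ φ-proper η in
       (∃[ α ] (IndependenceNumber P α × α ≤ a))
       × turánBound m a ℚ.≤ + edgeCount P / 1)
    ×
    (∀ (T : Graph m) →
       (∀ (C : Cycle K) → len C < r → Meets (Adj T) (Π φ C)) →
       (∃[ α ] (IndependenceNumber T α × α ≤ a))
       × turánBound m a ℚ.≤ + edgeCount T / 1)
    ×
    (Σ[ M ∈ List (Cycle K) ]
       ( All (λ C → len C < r) M
       × AllPairs (λ C D → Disjoint (Π φ C) (Π φ D)) M
       × (+ 1 / (r ∸ 1)) ℚ.* turánBound m a ℚ.≤ + length M / 1
       × AllPairs (λ C D → Disjoint (CycleEdge C) (CycleEdge D)) M ))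
-- Here `b` is r - 1 and `a` is k - 1, so h < k becomes `h ≤ a`. Two layers of each inequality are
-- matched to show that both are positive, as the divisions require.
theorem1p8 (suc b) (suc a) (s≤s (s≤s _)) (s≤s (s≤s _)) {n} {m}
           K K-chromatic (h , highGirth , s≤s h≤a) φ φ-proper _ =
  (λ η → bounds (monochromaticGraph K φ φ-proper η)
    (monochromatic-independence K K-chromatic φ φ-proper η)) ,
  (λ T meets → bounds T
    (transversal-independence K K-chromatic highGirth h≤a φ φ-proper T meets)) ,
  (let M , m²≤ = large-packing K K-chromatic highGirth h≤a φ φ-proper
       open Packing M
   in cycles , short , disjoint ,
      1/b*p≤ (length cycles) b (turánBound≤ m a (length cycles * b) m²≤) ,
      AllPairs.map (λ {C} {D} → disjoint-cycleEdges K φ C D) disjoint)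
  where
  bounds : ∀ G → IndependenceAtMost a G →
    (∃[ α ] (IndependenceNumber G α × α ≤ a)) × turánBound m a ℚ.≤ + edgeCount G / 1
  bounds G α≤a = independenceNumber≤ G α≤a , turánBound≤ m a (edgeCount G) (turán G α≤a)
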